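{- Let $k$ be a positive integer and let $G(x,k)=\sum_{n=0}^{\infty}M_n^{(k)}x^n$ be the ordinary generating function (a formal power series in $x$) of the higher order Mersenne sequence. Then $$G(x,k)=\frac{x}{(x-1)(2^kx-1)} .$$
   Context: The Mersenne numbers $\{M_n\}_{n\ge 0}$ are defined by $M_0=0$, $M_1=1$, $M_{n+2}=3M_{n+1}-2M_n$, i.e. $M_n=2^n-1$. For a positive integer $k$, the higher order Mersenne numbers are $M_n^{(k)}=M_{kn}/M_k$ for $n=0,1,2,\dots$. -}

module Defs where

open import Data.Nat.Base as ℕ using (ℕ; zero; suc; _∸_; _^_)
open import Data.Nat.Properties using (m^n≡1⇒n≡0∨m≡1)
open import Data.Integer.Base as ℤ using (ℤ; +_; 0ℤ; 1ℤ)
import Data.Integer.Properties as ℤ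
open import Data.Integer.GCD using (gcd)
open import Data.Integer.Solver using (module +-*-Solver)
open import Data.Rational.Base as ℚ using (ℚ; 0ℚ; 1ℚ)
import Data.Rational.Properties as ℚ
import Data.Rational.Solver as ℚS
open import Algebra.Definitions.RawMonoid ℚ.+-0-rawMonoid using (sum)
open import Data.Fin.Base using (toℕ)
open import Data.Sum.Base using (inj₁; inj₂)
open import Relation.Binary.PropositionalEquality

infix  4 _≈_
infixl 6 _-_
infixl 7 _*_ _/_

fromℤ : ℤ → ℚ
fromℤ z = z ℚ./ 1

fromℤ-nonZero : ∀ {z} → z ≢ 0ℤ → ℚ.NonZero (fromℤ z)
fromℤ-nonZero {z} z≢0 = ℚ.≢-nonZero λ eq → z≢0 (trans (sym (ℚ.↥-/ z 1))
  (cong (ℤ._* gcd z 1ℤ) (ℚ.p≡0⇒↥p≡0 (fromℤ z) eq)))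

M : ℕ → ℤ
M 0             = 0ℤ
M 1             = 1ℤ
M (suc (suc n)) = + 3 ℤ.* M (suc n) ℤ.- + 2 ℤ.* M n

M-closed : ∀ n → M n ≡ + (2 ^ n) ℤ.- 1ℤ
M-closed 0             = refl
M-closed 1             = refl
M-closed (suc (suc n)) = begin
  + 3 ℤ.* M (suc n) ℤ.- + 2 ℤ.* M n
    ≡⟨ cong₂ (λ u v → + 3 ℤ.* u ℤ.- + 2 ℤ.* v) (M-closed (suc n)) (M-closed n) ⟩
  + 3 ℤ.* (+ (2 ^ suc n) ℤ.- 1ℤ) ℤ.- + 2 ℤ.* (a ℤ.- 1ℤ)
    ≡⟨ cong (λ u → + 3 ℤ.* (u ℤ.- 1ℤ) ℤ.- + 2 ℤ.* (a ℤ.- 1ℤ)) (ℤ.pos-* 2 (2 ^ n)) ⟩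
  + 3 ℤ.* (+ 2 ℤ.* a ℤ.- 1ℤ) ℤ.- + 2 ℤ.* (a ℤ.- 1ℤ)
    ≡⟨ solve 1 (λ a → con (+ 3) :* (con (+ 2) :* a :- con 1ℤ) :- con (+ 2) :* (a :- con 1ℤ)
                   := con (+ 2) :* (con (+ 2) :* a) :- con 1ℤ) refl a ⟩
  + 2 ℤ.* (+ 2 ℤ.* a) ℤ.- 1ℤ
    ≡⟨ cong (λ u → + 2 ℤ.* u ℤ.- 1ℤ) (ℤ.pos-* 2 (2 ^ n)) ⟨
  + 2 ℤ.* + (2 ^ suc n) ℤ.- 1ℤ
    ≡⟨ cong (ℤ._- 1ℤ) (ℤ.pos-* 2 (2 ^ suc n)) ⟨
  + (2 ^ suc (suc n)) ℤ.- 1ℤ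
    ∎
  where
  open ≡-Reasoning
  open +-*-Solver
  a : ℤ
  a = + (2 ^ n)

M≢0 : ∀ k .{{_ : ℕ.NonZero k}} → M k ≢ 0ℤ
M≢0 k@(suc _) eq with m^n≡1⇒n≡0∨m≡1 2 k
  (ℤ.+-injective (ℤ.i-j≡0⇒i≡j _ _ (trans (sym (M-closed k)) eq)))
... | inj₁ ()
... | inj₂ ()

-- M⁽ k ⁾ n is the quotient M_{kn} / M_k, taken in ℚ.
M⁽_⁾ : (k : ℕ) .{{_ : ℕ.NonZero k}} → ℕ → ℚ
M⁽ k ⁾ n = (fromℤ (M (k ℕ.* n)) ℚ.÷ fromℤ (M k)) {{fromℤ-nonZero (M≢0 k)}}

-- Formal power series over ℚ, as coefficient sequences compared pointwise.
PowerSeries : Set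
PowerSeries = ℕ → ℚ

_≈_ : PowerSeries → PowerSeries → Set
f ≈ g = ∀ n → f n ≡ g n

const : ℚ → PowerSeries
const c zero    = c
const c (suc _) = 0ℚ

1# : PowerSeries
1# = const 1ℚ

X : PowerSeries
X 1 = 1ℚ
X _ = 0ℚ

_-_ : PowerSeries → PowerSeries → PowerSeries
(f - g) n = f n ℚ.- g n

_*_ : PowerSeries → PowerSeries → PowerSeries
(f * g) n = sum {suc n} λ i → f (toℕ i) ℚ.* g (n ∸ toℕ i)

-- Long division by a series with nonzero constant term, i.e. by a unit of
-- ℚ[[X]]: with q = f 0 / g 0 we have f - q g = X h, and f / g = q + X (h / g).
_/_ : (f g : PowerSeries) .{{_ : ℚ.NonZero (g 0)}} → PowerSeries
(f / g) zero    = f 0 ℚ.÷ g 0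
(f / g) (suc n) = ((λ i → f (suc i) ℚ.- (f 0 ℚ.÷ g 0) ℚ.* g (suc i)) / g) n

/-*-cancel : ∀ f g .{{_ : ℚ.NonZero (g 0)}} → (f / g) * g ≈ f
/-*-cancel f g zero = begin
  f 0 ℚ.* ℚ.1/ g 0 ℚ.* g 0 ℚ.+ 0ℚ   ≡⟨ ℚ.+-identityʳ _ ⟩
  f 0 ℚ.* ℚ.1/ g 0 ℚ.* g 0          ≡⟨ ℚ.*-assoc (f 0) _ _ ⟩
  f 0 ℚ.* (ℚ.1/ g 0 ℚ.* g 0)        ≡⟨ cong (f 0 ℚ.*_) (ℚ.*-inverseˡ (g 0)) ⟩
  f 0 ℚ.* 1ℚ                        ≡⟨ ℚ.*-identityʳ _ ⟩
  f 0                               ∎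
  where open ≡-Reasoning
/-*-cancel f g (suc n) = trans
  (cong (q ℚ.* g (suc n) ℚ.+_) (/-*-cancel (λ i → f (suc i) ℚ.- q ℚ.* g (suc i)) g n))
  (solve 2 (λ a b → a :+ (b :- a) := b) refl (q ℚ.* g (suc n)) (f (suc n)))
  where
  open ℚS.+-*-Solver
  q : ℚ
  q = f 0 ℚ.÷ g 0

G : (k : ℕ) .{{_ : ℕ.NonZero k}} → PowerSeries
G k n = M⁽ k ⁾ n

denominator-nonZero : ∀ c → ℚ.NonZero (((X - 1#) * (const c * X - 1#)) 0)
denominator-nonZero c rewrite ℚ.*-zeroʳ c = _

{-# OPTIONS --safe #-}
module Submission where

-- By M_{k+m} = 2^k M_m + M_k, the sequence g = M⁽ k ⁾ satisfies g_{n+1} = c g_n + 1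
-- with c = 2^k, so the denominator 1 - (c + 1) X + c X² times G is X; and a quotient
-- of power series is determined by its product with the denominator.

open import Defs
open import Data.Nat.Base as ℕ using (ℕ; zero; suc; NonZero; _^_)
import Data.Nat.Properties as ℕ
open import Data.Integer.Base as ℤ using (ℤ; +_; 1ℤ)
import Data.Integer.Properties as ℤ
open import Data.Integer.Solver using () renaming (module +-*-Solver to ℤ-Solver)
open import Data.Nat.Coprimality as Coprime using (1-coprimeTo)
open import Data.Rational.Base as ℚ using (ℚ; mkℚ; 0ℚ; 1ℚ)
import Data.Rational.Properties as ℚ
open import Data.Rational.Solver using () renaming (module +-*-Solver to ℚ-Solver)
open import Relation.Binary.PropositionalEquality
open ≡-Reasoning

-- Unlike fromℤ z, whose normal form needs a gcd, this is a constructor form on which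
-- the operations of ℚ compute.
mkℤ : ℤ → ℚ
mkℤ z = mkℚ z 0 (Coprime.sym (1-coprimeTo ℤ.∣ z ∣))

mkℤ≡fromℤ : ∀ z → mkℤ z ≡ fromℤ z
mkℤ≡fromℤ z = sym (ℚ.↥p/↧p≡p (mkℤ z))

fromℤ-homo-+ : ∀ a b → fromℤ (a ℤ.+ b) ≡ fromℤ a ℚ.+ fromℤ b
fromℤ-homo-+ a b = begin
  -- The factors `1ℤ` are inserted to match the cross-multiplied numerator to which
  -- `mkℤ a ℚ.+ mkℤ b` computes, so that the next step is definitional.
  fromℤ (a ℤ.+ b)                     ≡⟨ cong₂ (λ u v → fromℤ (u ℤ.+ v)) (ℤ.*-identityʳ a) (ℤ.*-identityʳ b) ⟨
  fromℤ (a ℤ.* 1ℤ ℤ.+ b ℤ.* 1ℤ)       ≡⟨⟩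
  mkℤ a ℚ.+ mkℤ b                     ≡⟨ cong₂ ℚ._+_ (mkℤ≡fromℤ a) (mkℤ≡fromℤ b) ⟩
  fromℤ a ℚ.+ fromℤ b                 ∎

-- Both constructor forms have denominator 1, so `mkℤ a ℚ.* mkℤ b` computes to the left-hand side
-- and only the two factors need converting.
fromℤ-homo-* : ∀ a b → fromℤ (a ℤ.* b) ≡ fromℤ a ℚ.* fromℤ b
fromℤ-homo-* a b = cong₂ ℚ._*_ (mkℤ≡fromℤ a) (mkℤ≡fromℤ b)

M-+ : ∀ m n → M (m ℕ.+ n) ≡ + (2 ^ m) ℤ.* M n ℤ.+ M m
M-+ m n = begin
  M (m ℕ.+ n)                            ≡⟨ M-closed (m ℕ.+ n) ⟩
  + (2 ^ (m ℕ.+ n)) ℤ.- 1ℤ               ≡⟨ cong (λ u → + u ℤ.- 1ℤ) (ℕ.^-distribˡ-+-* 2 m n) ⟩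
  + (2 ^ m ℕ.* 2 ^ n) ℤ.- 1ℤ             ≡⟨ cong (ℤ._- 1ℤ) (ℤ.pos-* (2 ^ m) (2 ^ n)) ⟩
  a ℤ.* b ℤ.- 1ℤ                         ≡⟨ solve 2 (λ a b → a :* b :- con 1ℤ := a :* (b :- con 1ℤ) :+ (a :- con 1ℤ)) refl a b ⟩
  a ℤ.* (b ℤ.- 1ℤ) ℤ.+ (a ℤ.- 1ℤ)        ≡⟨ cong₂ (λ u v → a ℤ.* u ℤ.+ v) (M-closed n) (M-closed m) ⟨
  a ℤ.* M n ℤ.+ M m                      ∎
  where
  open ℤ-Solver
  a b : ℤ
  a = + (2 ^ m)
  b = + (2 ^ n)

module _ (k : ℕ) .{{_ : NonZero k}} where

  private
    c : ℚ
    c = fromℤ (+ (2 ^ k))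

    instance
      fromℤ-M-nonZero : ℚ.NonZero (fromℤ (M k))
      fromℤ-M-nonZero = fromℤ-nonZero (M≢0 k)

    -- Division is multiplication by the inverse, so `G k n` is definitionally
    -- `fromℤ (M (k ℕ.* n)) ℚ.* d⁻¹`.
    d⁻¹ : ℚ
    d⁻¹ = ℚ.1/ fromℤ (M k)

  G-zero : G k 0 ≡ 0ℚ
  G-zero = begin
    fromℤ (M (k ℕ.* 0)) ℚ.* d⁻¹   ≡⟨ cong (λ m → fromℤ (M m) ℚ.* d⁻¹) (ℕ.*-zeroʳ k) ⟩
    0ℚ ℚ.* d⁻¹                    ≡⟨ ℚ.*-zeroˡ d⁻¹ ⟩
    0ℚ                            ∎

  G-suc : ∀ n → G k (suc n) ≡ c ℚ.* G k n ℚ.+ 1ℚ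
  G-suc n = begin
    fromℤ (M (k ℕ.* suc n)) ℚ.* d⁻¹
      ≡⟨ cong (λ m → fromℤ (M m) ℚ.* d⁻¹) (ℕ.*-suc k n) ⟩
    fromℤ (M (k ℕ.+ k ℕ.* n)) ℚ.* d⁻¹
      ≡⟨ cong (λ z → fromℤ z ℚ.* d⁻¹) (M-+ k (k ℕ.* n)) ⟩
    fromℤ (+ (2 ^ k) ℤ.* M (k ℕ.* n) ℤ.+ M k) ℚ.* d⁻¹
      ≡⟨ cong (ℚ._* d⁻¹) (fromℤ-homo-+ (+ (2 ^ k) ℤ.* M (k ℕ.* n)) (M k)) ⟩
    (fromℤ (+ (2 ^ k) ℤ.* M (k ℕ.* n)) ℚ.+ fromℤ (M k)) ℚ.* d⁻¹
      ≡⟨ cong (λ u → (u ℚ.+ fromℤ (M k)) ℚ.* d⁻¹) (fromℤ-homo-* (+ (2 ^ k)) (M (k ℕ.* n))) ⟩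
    (c ℚ.* fromℤ (M (k ℕ.* n)) ℚ.+ fromℤ (M k)) ℚ.* d⁻¹
      ≡⟨ solve 4 (λ c m d e → (c :* m :+ d) :* e := c :* (m :* e) :+ d :* e) refl
           c (fromℤ (M (k ℕ.* n))) (fromℤ (M k)) d⁻¹ ⟩
    c ℚ.* G k n ℚ.+ fromℤ (M k) ℚ.* d⁻¹
      ≡⟨ cong (c ℚ.* G k n ℚ.+_) (ℚ.*-inverseʳ (fromℤ (M k))) ⟩
    c ℚ.* G k n ℚ.+ 1ℚ
      ∎
    where open ℚ-Solver

-- Follows the long division: comparing constant terms forces `h 0` to be the first quotient digit,
-- and the shifted `h` then solves the same problem for the remainder series.
/-unique : ∀ h f g .{{_ : ℚ.NonZero (g 0)}} → h * g ≈ f → h ≈ f / g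
/-unique h f g h*g≈f = λ where
    zero    → h₀≡q
    (suc n) → /-unique (λ i → h (suc i)) _ g tail n
  where
  open ℚ-Solver
  q : ℚ
  q = f 0 ℚ.÷ g 0

  h₀≡q : h 0 ≡ q
  h₀≡q = begin
    h 0                               ≡⟨ ℚ.*-identityʳ (h 0) ⟨
    h 0 ℚ.* 1ℚ                        ≡⟨ cong (h 0 ℚ.*_) (ℚ.*-inverseʳ (g 0)) ⟨
    -- The summand `0ℚ` is the empty rest of the sum to which `(h * g) 0` unfolds.
    h 0 ℚ.* (g 0 ℚ.* ℚ.1/ g 0)        ≡⟨ solve 3 (λ a b e → a :* (b :* e) := (a :* b :+ con 0ℚ) :* e) refl (h 0) (g 0) (ℚ.1/ g 0) ⟩
    (h 0 ℚ.* g 0 ℚ.+ 0ℚ) ℚ.* ℚ.1/ g 0 ≡⟨ cong (ℚ._* ℚ.1/ g 0) (h*g≈f 0) ⟩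
    q                                 ∎

  tail : (λ i → h (suc i)) * g ≈ λ i → f (suc i) ℚ.- q ℚ.* g (suc i)
  tail n = begin
    -- The convolution splits off its first term by computation: `(h * g) (suc n)` is
    -- `h 0 ℚ.* g (suc n) ℚ.+ t`, where `t` convolves the shifted `h` with `g`.
    t                                            ≡⟨ solve 2 (λ t u → t := (u :+ t) :- u) refl t (h 0 ℚ.* g (suc n)) ⟩
    h 0 ℚ.* g (suc n) ℚ.+ t ℚ.- h 0 ℚ.* g (suc n) ≡⟨ cong₂ (λ a b → a ℚ.- b ℚ.* g (suc n)) (h*g≈f (suc n)) h₀≡q ⟩
    f (suc n) ℚ.- q ℚ.* g (suc n)                ∎
    where
    t : ℚ
    t = ((λ i → h (suc i)) * g) n

zero-* : ∀ e f → (∀ i → e i ≡ 0ℚ) → ∀ n → (e * f) n ≡ 0ℚ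
zero-* e f e≡0 zero    = begin
  e 0 ℚ.* f 0 ℚ.+ 0ℚ ≡⟨ cong (λ u → u ℚ.* f 0 ℚ.+ 0ℚ) (e≡0 0) ⟩
  0ℚ ℚ.* f 0 ℚ.+ 0ℚ  ≡⟨ cong (ℚ._+ 0ℚ) (ℚ.*-zeroˡ (f 0)) ⟩
  0ℚ                 ∎
zero-* e f e≡0 (suc n) = begin
  e 0 ℚ.* f (suc n) ℚ.+ t   ≡⟨ cong₂ (λ u v → u ℚ.* f (suc n) ℚ.+ v) (e≡0 0) (zero-* _ f (λ i → e≡0 (suc i)) n) ⟩
  0ℚ ℚ.* f (suc n) ℚ.+ 0ℚ   ≡⟨ cong (ℚ._+ 0ℚ) (ℚ.*-zeroˡ (f (suc n))) ⟩
  0ℚ                        ∎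
  where
  t : ℚ
  t = ((λ i → e (suc i)) * f) n

constant-* : ∀ e f → (∀ i → e (suc i) ≡ 0ℚ) → ∀ n → (e * f) n ≡ e 0 ℚ.* f n
constant-* e f e≡0 zero    = ℚ.+-identityʳ (e 0 ℚ.* f 0)
constant-* e f e≡0 (suc n) = begin
  e 0 ℚ.* f (suc n) ℚ.+ ((λ i → e (suc i)) * f) n ≡⟨ cong (e 0 ℚ.* f (suc n) ℚ.+_) (zero-* _ f e≡0 n) ⟩
  e 0 ℚ.* f (suc n) ℚ.+ 0ℚ                        ≡⟨ ℚ.+-identityʳ _ ⟩
  e 0 ℚ.* f (suc n)                               ∎

-- Meant for the factor `X - 1#`, which has degree 1, so that the product combines two neighbouring
-- coefficients of `f`.
linear-* : ∀ e f → (∀ i → e (suc (suc i)) ≡ 0ℚ) →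
           ∀ n → (e * f) (suc n) ≡ e 0 ℚ.* f (suc n) ℚ.+ e 1 ℚ.* f n
linear-* e f e≡0 n = cong (e 0 ℚ.* f (suc n) ℚ.+_) (constant-* (λ i → e (suc i)) f e≡0 n)

module _ (c : ℚ) where

  open ℚ-Solver

  private
    B D : PowerSeries
    B = const c * X - 1#
    D = (X - 1#) * B

    B-coeff : ∀ n → B n ≡ c ℚ.* X n ℚ.- 1# n
    B-coeff n = cong (ℚ._- 1# n) (constant-* (const c) X (λ _ → refl) n)

    -- The right-hand side keeps `X` and `1#` unevaluated; at each concrete index below they reduce
    -- to numerals and the solver finishes.
    D-suc : ∀ n → D (suc n) ≡ (c ℚ.* X n ℚ.- 1# n) ℚ.- (c ℚ.* X (suc n) ℚ.- 1# (suc n))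
    D-suc n = begin
      D (suc n)                                       ≡⟨ linear-* (X - 1#) B (λ _ → refl) n ⟩
      ℚ.- 1ℚ ℚ.* B (suc n) ℚ.+ 1ℚ ℚ.* B n             ≡⟨ solve 2 (λ a b → con (ℚ.- 1ℚ) :* a :+ con 1ℚ :* b := b :- a) refl (B (suc n)) (B n) ⟩
      B n ℚ.- B (suc n)                               ≡⟨ cong₂ ℚ._-_ (B-coeff n) (B-coeff (suc n)) ⟩
      _                                               ∎

  D-0 : D 0 ≡ 1ℚ
  D-0 = trans (cong (λ u → ℚ.- 1ℚ ℚ.* u ℚ.+ 0ℚ) (B-coeff 0))
    (solve 1 (λ c → con (ℚ.- 1ℚ) :* (c :* con 0ℚ :- con 1ℚ) :+ con 0ℚ := con 1ℚ) refl c)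

  D-1 : D 1 ≡ ℚ.- (c ℚ.+ 1ℚ)
  D-1 = trans (D-suc 0)
    (solve 1 (λ c → (c :* con 0ℚ :- con 1ℚ) :- (c :* con 1ℚ :- con 0ℚ) := :- (c :+ con 1ℚ)) refl c)

  D-2 : D 2 ≡ c
  D-2 = trans (D-suc 1)
    (solve 1 (λ c → (c :* con 1ℚ :- con 0ℚ) :- (c :* con 0ℚ :- con 0ℚ) := c) refl c)

  D-3+ : ∀ n → D (suc (suc (suc n))) ≡ 0ℚ
  D-3+ n = trans (D-suc (suc (suc n)))
    (solve 1 (λ c → (c :* con 0ℚ :- con 0ℚ) :- (c :* con 0ℚ :- con 0ℚ) := con 0ℚ) refl c)

  -- The coefficient is h_{n+2} - (c + 1) h_{n+1} + c h_n, the difference of two consecutive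
  -- instances of the recurrence. The starting value is left arbitrary because the induction
  -- replaces `h` by its shift, which keeps the recurrence but changes `h 0`.
  *-denominator-2+ : ∀ h → (∀ n → h (suc n) ≡ c ℚ.* h n ℚ.+ 1ℚ) → ∀ n → (h * D) (suc (suc n)) ≡ 0ℚ
  *-denominator-2+ h rec zero = begin
    h 0 ℚ.* D 2 ℚ.+ (h 1 ℚ.* D 1 ℚ.+ (h 2 ℚ.* D 0 ℚ.+ 0ℚ))
      ≡⟨ cong₂ ℚ._+_ (cong (h 0 ℚ.*_) D-2) (cong₂ ℚ._+_ (cong₂ ℚ._*_ (rec 0) D-1)
           (cong (ℚ._+ 0ℚ) (cong₂ ℚ._*_ h-2 D-0))) ⟩
    h 0 ℚ.* c ℚ.+ ((c ℚ.* h 0 ℚ.+ 1ℚ) ℚ.* (ℚ.- (c ℚ.+ 1ℚ)) ℚ.+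
      ((c ℚ.* (c ℚ.* h 0 ℚ.+ 1ℚ) ℚ.+ 1ℚ) ℚ.* 1ℚ ℚ.+ 0ℚ))
      ≡⟨ solve 2 (λ c a → a :* c :+ ((c :* a :+ con 1ℚ) :* (:- (c :+ con 1ℚ)) :+
           ((c :* (c :* a :+ con 1ℚ) :+ con 1ℚ) :* con 1ℚ :+ con 0ℚ)) := con 0ℚ) refl c (h 0) ⟩
    0ℚ
      ∎
    where
    h-2 : h 2 ≡ c ℚ.* (c ℚ.* h 0 ℚ.+ 1ℚ) ℚ.+ 1ℚ
    h-2 = trans (rec 1) (cong (λ u → c ℚ.* u ℚ.+ 1ℚ) (rec 0))
  *-denominator-2+ h rec (suc n) = begin
    -- The split-off term lies beyond the degree of `D`; the rest is the same coefficient problem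
    -- for the shifted `h`.
    h 0 ℚ.* D (suc (suc (suc n))) ℚ.+ t  ≡⟨ cong₂ (λ u v → h 0 ℚ.* u ℚ.+ v) (D-3+ n) (*-denominator-2+ _ (λ i → rec (suc i)) n) ⟩
    h 0 ℚ.* 0ℚ ℚ.+ 0ℚ                    ≡⟨ cong (ℚ._+ 0ℚ) (ℚ.*-zeroʳ (h 0)) ⟩
    0ℚ                                   ∎
    where
    t : ℚ
    t = ((λ i → h (suc i)) * D) (suc (suc n))

  -- The initial value enters only in the two lowest coefficients: h_0 = 0 and h_1 - (c + 1) h_0 =
  -- 1.
  *-denominator : ∀ h → h 0 ≡ 0ℚ → (∀ n → h (suc n) ≡ c ℚ.* h n ℚ.+ 1ℚ) → h * D ≈ X
  *-denominator h h₀≡0 rec 0 = cong (ℚ._+ 0ℚ) (cong₂ ℚ._*_ h₀≡0 D-0)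
  *-denominator h h₀≡0 rec 1 = begin
    h 0 ℚ.* D 1 ℚ.+ (h 1 ℚ.* D 0 ℚ.+ 0ℚ)
      ≡⟨ cong₂ ℚ._+_ (cong₂ ℚ._*_ h₀≡0 D-1) (cong (ℚ._+ 0ℚ) (cong₂ ℚ._*_ h-1 D-0)) ⟩
    0ℚ ℚ.* (ℚ.- (c ℚ.+ 1ℚ)) ℚ.+ ((c ℚ.* 0ℚ ℚ.+ 1ℚ) ℚ.* 1ℚ ℚ.+ 0ℚ)
      ≡⟨ solve 1 (λ c → con 0ℚ :* (:- (c :+ con 1ℚ)) :+ ((c :* con 0ℚ :+ con 1ℚ) :* con 1ℚ :+ con 0ℚ) := con 1ℚ) refl c ⟩
    1ℚ
      ∎
    where
    h-1 : h 1 ≡ c ℚ.* 0ℚ ℚ.+ 1ℚ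
    h-1 = trans (rec 0) (cong (λ u → c ℚ.* u ℚ.+ 1ℚ) h₀≡0)
  *-denominator h h₀≡0 rec (suc (suc n)) = *-denominator-2+ h rec n

theorem2p13 : (k : ℕ) .{{_ : NonZero k}} →
    let c = fromℤ (+ (2 ^ k)) in
    G k ≈ (X / ((X - 1#) * (const c * X - 1#))) {{denominator-nonZero c}}
theorem2p13 k = /-unique (G k) X _ {{denominator-nonZero c}} (*-denominator c (G k) (G-zero k) (G-suc k))
  where
  c : ℚ
  c = fromℤ (+ (2 ^ k))
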